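{- There is an absolute constant $C>0$ such that the following holds. Let $k\ge 2$ be an even integer and let $Q$ be a permutation matrix contained in $X_k$. Then \[ c_Q \le 2^{C\log^2 k}. \]
   Context: For an even integer $k\ge 2$, $X_k$ is the $k\times k$ binary matrix with $1$-entries exactly at the positions $(i,j)$, $i,j\in[k]$, with $i=j$ or $i+j=k+1$. A binary matrix $A$ contains a binary matrix $B$ if $B$ can be obtained from $A$ by deleting some rows, some columns, and changing some $1$-entries to $0$-entries; otherwise $A$ avoids $B$. A permutation matrix is a square binary matrix with exactly one $1$-entry in each row and each column. $\mathrm{ex}(n,B)$ is the maximum number of $1$-entries in an $n\times n$ binary matrix avoiding $B$. For a permutation matrix $P$, $c_P=\lim_{n\to\infty}\mathrm{ex}(n,P)/n$ (this limit exists and is finite). Logarithms are base $2$. -}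

module Defs where

open import Data.Nat using (ℕ; zero; suc; _+_; _*_; _^_; _≤_; _<_; _≡ᵇ_)
open import Data.Nat.Logarithm using (⌊log₂_⌋)
open import Data.Bool using (Bool; true; false; _∨_; if_then_else_)
open import Data.Fin using (Fin; toℕ) renaming (zero to fzero; suc to fsuc)
import Data.Fin as F
open import Data.Product using (Σ; ∃; _×_)
open import Relation.Binary.PropositionalEquality using (_≡_)

Matrix : ℕ → ℕ → Set
Matrix m n = Fin m → Fin n → Bool

countTrue : ∀ n → (Fin n → Bool) → ℕ
countTrue zero    v = 0
countTrue (suc n) v = (if v fzero then 1 else 0) + countTrue n (λ i → v (fsuc i))

ones : ∀ {m n} → Matrix m n → ℕ
ones {zero}  {n} A = 0
ones {suc m} {n} A = countTrue n (A fzero) + ones {m} {n} (λ i → A (fsuc i))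

StrictlyIncreasing : ∀ {k n} → (Fin k → Fin n) → Set
StrictlyIncreasing f = ∀ i j → i F.< j → f i F.< f j

Contains : ∀ {m n p q} → Matrix m n → Matrix p q → Set
Contains {m} {n} {p} {q} A B =
  Σ (Fin p → Fin m) λ r → Σ (Fin q → Fin n) λ c →
    StrictlyIncreasing r × StrictlyIncreasing c ×
    (∀ i j → B i j ≡ true → A (r i) (c j) ≡ true)

Avoids : ∀ {m n p q} → Matrix m n → Matrix p q → Set
Avoids A B = Contains A B → Data.Empty.⊥
  where import Data.Empty

IsPermutationMatrix : ∀ {l} → Matrix l l → Set
IsPermutationMatrix {l} Q =
  (∀ i → Σ (Fin l) λ j → Q i j ≡ true × (∀ j' → Q i j' ≡ true → j' ≡ j)) ×
  (∀ j → Σ (Fin l) λ i → Q i j ≡ true × (∀ i' → Q i' j ≡ true → i' ≡ i))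

-- X_k: 1-entries exactly at (i,j) with i = j or i + j = k + 1 (1-based);
-- with 0-based indices i0,j0 this is i0 = j0 or i0 + j0 + 1 = k.
X : (k : ℕ) → Matrix k k
X k i j = (toℕ i ≡ᵇ toℕ j) ∨ ((toℕ i + toℕ j + 1) ≡ᵇ k)

-- c_P ≤ b (for the limit c_P = lim ex(n,P)/n, which exists):
-- for every ε = 1/(m+1) > 0, eventually ex(n,P)/n ≤ b + ε,
-- i.e. (m+1)·ex(n,P) ≤ (m+1)·b·n + n.
cBoundedBy : ∀ {p q} → Matrix p q → ℕ → Set
cBoundedBy P b = ∀ (m : ℕ) → ∃ λ N → ∀ n → N ≤ n →
  ∀ (A : Matrix n n) → Avoids A P → suc m * ones A ≤ suc m * b * n + n

-- Marcus–Tardos block contraction, with the pigeonhole bound on the number of wide blocks replaced by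
-- a density decrement.  Cut a matrix avoiding Q into s × s blocks and call a block wide if at least t
-- of its columns are nonempty, where s is quadratic in t and t is linear in k.  Within one strip,
-- let C be the set of columns met by an interval of (2k)^L consecutive wide blocks.  Split the interval
-- into 2k parts.  If some part meets fewer than 31/32 of C, pass to it; since |C| stays between t and
-- s, this happens O(log k) times.  Otherwise the parts and the columns of C form a dense matrix.  By
-- averaging, some translate of X_{2k} in it has at least half of its nested four-entry layers intact,
-- and these form an X_k.  So there are at most (2k)^{O(log k)} = 2^{O(log² k)} wide blocks per strip.
module Submission where

open import Defs
open import Data.Nat using (ℕ; zero; suc; _+_; _*_; _∸_; _^_; _≤_; _<_; z≤n; s≤s; z<s; s<s; NonZero; >-nonZero; _<?_; _≤?_; _≤ᵇ_; _≡ᵇ_)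
open import Data.Nat.Properties
open import Data.Nat.DivMod using (_/_; _%_; m≡m%n+[m/n]*n; m%n<n; m/n*n≤m)
open import Data.Nat.Induction using (<-rec)
open import Data.Nat.Tactic.RingSolver using (solve-∀)
open import Data.Nat.Divisibility using (_∣_; divides)
open import Data.Nat.Logarithm using (⌊log₂_⌋; ⌊log₂⌋-mono-≤; ⌊log₂[2^n]⌋≡n)
open import Data.Bool using (Bool; true; false; T; _∧_; _∨_; not; if_then_else_)
open import Data.Bool.Properties using (∨-zeroʳ)
open import Data.Fin using (Fin; toℕ) renaming (zero to fzero; suc to fsuc)
import Data.Fin as F
open import Data.Fin.Properties using (toℕ-injective; toℕ<n)
open import Data.Product using (Σ; ∃; _×_; _,_; proj₁; proj₂)
open import Data.Sum using (_⊎_; inj₁; inj₂)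
open import Data.Empty using (⊥-elim)
open import Function using (_∘_; flip; case_of_)
open import Relation.Nullary using (¬_; yes; no)
open import Relation.Binary.PropositionalEquality using (_≡_; refl; sym; trans; cong; cong₂; subst; subst₂)

open ≤-Reasoning

-- Finite sums, counts and enumerations over initial segments of the naturals.

⟦_⟧ : Bool → ℕ
⟦ b ⟧ = if b then 1 else 0

∑ : ℕ → (ℕ → ℕ) → ℕ
∑ zero    f = 0
∑ (suc n) f = f 0 + ∑ n (f ∘ suc)

count : ℕ → (ℕ → Bool) → ℕ
count n f = ∑ n (⟦_⟧ ∘ f)

any< : ℕ → (ℕ → Bool) → Bool
any< zero    f = false
any< (suc n) f = f 0 ∨ any< n (f ∘ suc)

∑-cong : ∀ n {f g : ℕ → ℕ} → (∀ i → f i ≡ g i) → ∑ n f ≡ ∑ n g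
∑-cong zero    h = refl
∑-cong (suc n) h = cong₂ _+_ (h 0) (∑-cong n (h ∘ suc))

∑-mono : ∀ n {f g : ℕ → ℕ} → (∀ i → i < n → f i ≤ g i) → ∑ n f ≤ ∑ n g
∑-mono zero    h = z≤n
∑-mono (suc n) h = +-mono-≤ (h 0 z<s) (∑-mono n λ i i<n → h (suc i) (s<s i<n))

∑-const : ∀ n c → ∑ n (λ _ → c) ≡ n * c
∑-const zero    c = refl
∑-const (suc n) c = cong (c +_) (∑-const n c)

∑-+ : ∀ n (f g : ℕ → ℕ) → ∑ n (λ i → f i + g i) ≡ ∑ n f + ∑ n g
∑-+ zero    f g = refl
∑-+ (suc n) f g = trans (cong (f 0 + g 0 +_) (∑-+ n (f ∘ suc) (g ∘ suc)))
                        (+-interchange (f 0) (g 0) (∑ n (f ∘ suc)) (∑ n (g ∘ suc)))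
  where
  +-interchange : ∀ a b c d → a + b + (c + d) ≡ a + c + (b + d)
  +-interchange = solve-∀

∑-*ˡ : ∀ n c (f : ℕ → ℕ) → ∑ n (λ i → c * f i) ≡ c * ∑ n f
∑-*ˡ zero    c f = sym (*-zeroʳ c)
∑-*ˡ (suc n) c f = trans (cong (c * f 0 +_) (∑-*ˡ n c (f ∘ suc))) (sym (*-distribˡ-+ c (f 0) _))

∑-*ʳ : ∀ n c (f : ℕ → ℕ) → ∑ n (λ i → f i * c) ≡ ∑ n f * c
∑-*ʳ n c f = trans (∑-cong n λ i → *-comm (f i) c) (trans (∑-*ˡ n c f) (*-comm c _))

∑-swap : ∀ m n (f : ℕ → ℕ → ℕ) → ∑ m (λ i → ∑ n (f i)) ≡ ∑ n (λ j → ∑ m (λ i → f i j))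
∑-swap zero    n f = sym (trans (∑-const n 0) (*-zeroʳ n))
∑-swap (suc m) n f = trans (cong (∑ n (f 0) +_) (∑-swap m n (f ∘ suc)))
                           (sym (∑-+ n (f 0) (λ j → ∑ m (λ i → f (suc i) j))))

∑-split : ∀ a b (f : ℕ → ℕ) → ∑ (a + b) f ≡ ∑ a f + ∑ b (λ i → f (a + i))
∑-split zero    b f = refl
∑-split (suc a) b f = trans (cong (f 0 +_) (∑-split a b (f ∘ suc))) (sym (+-assoc (f 0) _ _))

∑-range : ∀ {m n} (f : ℕ → ℕ) → m ≤ n → ∑ m f ≤ ∑ n f
∑-range f z≤n       = z≤n
∑-range f (s≤s m≤n) = +-monoʳ-≤ (f 0) (∑-range (f ∘ suc) m≤n)

∑-window : ∀ a b {n} (f : ℕ → ℕ) → a + b ≤ n → ∑ b (λ i → f (a + i)) ≤ ∑ n f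
∑-window a b {n} f le = begin
  ∑ b (λ i → f (a + i))           ≤⟨ m≤n+m _ (∑ a f) ⟩
  ∑ a f + ∑ b (λ i → f (a + i))   ≡⟨ ∑-split a b f ⟨
  ∑ (a + b) f                     ≤⟨ ∑-range f le ⟩
  ∑ n f                           ∎

∑-blocks : ∀ n s (f : ℕ → ℕ) → ∑ (n * s) f ≡ ∑ n (λ i → ∑ s (λ x → f (i * s + x)))
∑-blocks zero    s f = refl
∑-blocks (suc n) s f = trans (∑-split s (n * s) f) (cong (∑ s f +_)
  (trans (∑-blocks n s (λ i → f (s + i)))
         (∑-cong n λ i → ∑-cong s λ x → cong f (sym (+-assoc s (i * s) x)))))

∑-pigeonhole : ∀ n v (f : ℕ → ℕ) → ∑ n f < n * suc v → ∃ λ i → i < n × f i ≤ v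
∑-pigeonhole (suc n) v f lt with f 0 ≤? v
... | yes p = 0 , z<s , p
... | no ¬p with ∑-pigeonhole n v (f ∘ suc)
                  (+-cancelˡ-< (suc v) _ _ (≤-<-trans (+-monoˡ-≤ _ (≰⇒> ¬p)) lt))
...   | i , i<n , q = suc i , s<s i<n , q

⟦⟧≤1 : ∀ b → ⟦ b ⟧ ≤ 1
⟦⟧≤1 true  = ≤-refl
⟦⟧≤1 false = z≤n

⟦⟧-mono : ∀ {a b} → (a ≡ true → b ≡ true) → ⟦ a ⟧ ≤ ⟦ b ⟧
⟦⟧-mono {false} h = z≤n
⟦⟧-mono {true}  h rewrite h refl = ≤-refl

count≤ : ∀ n f → count n f ≤ n
count≤ n f = begin
  count n f         ≤⟨ ∑-mono n (λ i _ → ⟦⟧≤1 (f i)) ⟩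
  ∑ n (λ _ → 1)     ≡⟨ ∑-const n 1 ⟩
  n * 1             ≡⟨ *-identityʳ n ⟩
  n                 ∎

count-not : ∀ n f → count n f + count n (not ∘ f) ≡ n
count-not n f = trans (sym (∑-+ n _ _)) (trans (∑-cong n (λ i → one (f i)))
                  (trans (∑-const n 1) (*-identityʳ n)))
  where
  one : ∀ b → ⟦ b ⟧ + ⟦ not b ⟧ ≡ 1
  one true  = refl
  one false = refl

any-intro : ∀ n f {i} → i < n → f i ≡ true → any< n f ≡ true
any-intro (suc n) f {zero}  _         p rewrite p = refl
any-intro (suc n) f {suc i} (s≤s i<n) p rewrite any-intro n (f ∘ suc) i<n p = ∨-zeroʳ (f 0)

any-elim : ∀ n f → any< n f ≡ true → ∃ λ i → i < n × f i ≡ true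
any-elim (suc n) f p with f 0 in eq
... | true  = 0 , z<s , eq
... | false with any-elim n (f ∘ suc) p
...   | i , i<n , q = suc i , s<s i<n , q

∧-true : ∀ {a b} → a ∧ b ≡ true → a ≡ true × b ≡ true
∧-true {true} {true} _ = refl , refl

-- For i ≥ count s f the value is chosen so that enum s f stays strictly increasing on all of ℕ.
enum : ℕ → (ℕ → Bool) → ℕ → ℕ
enumStep : Bool → (ℕ → ℕ) → ℕ → ℕ
enum zero    f i = i
enum (suc s) f i = enumStep (f 0) (enum s (f ∘ suc)) i
enumStep false e i       = suc (e i)
enumStep true  e zero    = 0
enumStep true  e (suc i) = suc (e i)

enum-inc : ∀ s f {i j} → i < j → enum s f i < enum s f j
enum-inc zero    f i<j = i<j
enum-inc (suc s) f {i} {j} i<j with f 0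
... | false = s<s (enum-inc s (f ∘ suc) i<j)
enum-inc (suc s) f {zero}  {suc j} i<j       | true = z<s
enum-inc (suc s) f {suc i} {suc j} (s≤s i<j) | true = s<s (enum-inc s (f ∘ suc) i<j)

enum-true : ∀ s f {i} → i < count s f → f (enum s f i) ≡ true
enum-true (suc s) f {i} lt with f 0 in eq
... | false = enum-true s (f ∘ suc) lt
enum-true (suc s) f {zero}  lt       | true = eq
enum-true (suc s) f {suc i} (s≤s lt) | true = enum-true s (f ∘ suc) lt

enum-< : ∀ s f {i} → i < count s f → enum s f i < s
enum-< (suc s) f {i} lt with f 0
... | false = s<s (enum-< s (f ∘ suc) lt)
enum-< (suc s) f {zero}  lt       | true = z<s
enum-< (suc s) f {suc i} (s≤s lt) | true = s<s (enum-< s (f ∘ suc) lt)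

-- Replaces the elements of a set by their positions in its enumeration, so that a count inside the
-- set becomes a count over an interval, to which `∑-window` applies.
∑-enum : ∀ s f (g : ℕ → ℕ) → ∑ (count s f) (g ∘ enum s f) ≡ ∑ s (λ y → ⟦ f y ⟧ * g y)
∑-enum zero    f g = refl
∑-enum (suc s) f g with f 0
... | false = ∑-enum s (f ∘ suc) (g ∘ suc)
... | true  = cong₂ _+_ (sym (+-identityʳ (g 0))) (∑-enum s (f ∘ suc) (g ∘ suc))

-- Matrices indexed by all naturals, containment and contraction.

BMat : Set
BMat = ℕ → ℕ → Bool

Increasing : ∀ {l} → (Fin l → ℕ) → Set
Increasing f = ∀ i j → i F.< j → f i < f j

-- Rows and columns are unbounded, so blocks and translates carry no range proofs. Finite matrices
-- are padded with `false`, and `size` restricts to a window when entries are counted.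
Cont : ∀ {l} → BMat → Matrix l l → Set
Cont {l} A Q = Σ (Fin l → ℕ) λ r → Σ (Fin l → ℕ) λ c →
  Increasing r × Increasing c × (∀ i j → Q i j ≡ true → A (r i) (c j) ≡ true)

Separated : (ℕ → ℕ → Set) → Set
Separated P = ∀ {u v x y} → u < v → P u x → P v y → x < y

-- Each 1-entry of a permutation matrix is alone in its row and column, so the 1-entries of the copy
-- in `B` can be lifted to `A` independently of each other. Separation of `P` and `R` then keeps the
-- lifted rows and columns in order.
contract : ∀ {l} {Q : Matrix l l} → IsPermutationMatrix Q → ∀ (A B : BMat) (P R : ℕ → ℕ → Set) →
  Separated P → Separated R →
  (∀ u v → B u v ≡ true → ∃ λ x → ∃ λ y → A x y ≡ true × P u x × R v y) →
  Cont B Q → Cont A Q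
contract {l} {Q} (rows , cols) A B P R sepP sepR lift (r , c , rinc , cinc , sub) =
  x , y ∘ σ ,
  (λ i j i<j → sepP (rinc i j i<j) (x∈ i) (x∈ j)) ,
  (λ i j i<j → sepR (cinc i j i<j) (y∈ i) (y∈ j)) ,
  -- Column `j` takes its coordinate from the lift chosen for row `σ j`; a 1-entry at (i, j) forces
  -- `σ j` to be `i`, so both coordinates come from one lifted entry.
  λ i j q → subst (λ i' → A (x i) (y i') ≡ true) (proj₂ (proj₂ (cols j)) i q) (xy i)
  where
  π : Fin l → Fin l
  π i = proj₁ (rows i)
  σ : Fin l → Fin l
  σ j = proj₁ (cols j)
  pick : ∀ i → ∃ λ x → ∃ λ y → A x y ≡ true × P (r i) x × R (c (π i)) y
  pick i = lift (r i) (c (π i)) (sub i (π i) (proj₁ (proj₂ (rows i))))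
  x y : Fin l → ℕ
  x i = proj₁ (pick i)
  y i = proj₁ (proj₂ (pick i))
  xy : ∀ i → A (x i) (y i) ≡ true
  xy i = proj₁ (proj₂ (proj₂ (pick i)))
  x∈ : ∀ i → P (r i) (x i)
  x∈ i = proj₁ (proj₂ (proj₂ (proj₂ (pick i))))
  y∈ : ∀ j → R (c j) (y (σ j))
  y∈ j = subst (λ j' → R (c j') (y (σ j)))
    (sym (proj₂ (proj₂ (rows (σ j))) j (proj₁ (proj₂ (cols j)))))
    (proj₂ (proj₂ (proj₂ (proj₂ (pick (σ j))))))

Block : ℕ → ℕ → (ℕ → ℕ) → ℕ → ℕ → Set
Block a w f u x = ∃ λ d → d < w × x ≡ a + (f u * w + d)

Block-separated : ∀ a w f → (∀ {u v} → u < v → f u < f v) → Separated (Block a w f)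
Block-separated a w f inc {u} {v} u<v (d , d<w , refl) (e , _ , refl) = +-monoʳ-< a (begin-strict
  f u * w + d    <⟨ +-monoʳ-< (f u * w) d<w ⟩
  f u * w + w    ≡⟨ +-comm (f u * w) w ⟩
  suc (f u) * w  ≤⟨ *-monoˡ-≤ w (inc u<v) ⟩
  f v * w        ≤⟨ m≤m+n _ e ⟩
  f v * w + e    ∎)

record XPermutation (k : ℕ) {l : ℕ} (Q : Matrix l l) : Set where
  field
    perm   : IsPermutationMatrix Q
    r c    : Fin l → ℕ
    r-inc  : Increasing r
    c-inc  : Increasing c
    r<     : ∀ i → r i < k
    c<     : ∀ j → c j < k
    onX    : ∀ i j → Q i j ≡ true → r i ≡ c j ⊎ r i + c j + 1 ≡ k

-- Symmetry of X_k: whatever is proved about wide blocks applies to tall blocks after transposing.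
X-transpose : ∀ {k l} {Q : Matrix l l} → XPermutation k Q → XPermutation k (flip Q)
X-transpose X = record
  { perm = proj₂ perm , proj₁ perm ; r = c ; c = r ; r-inc = c-inc ; c-inc = r-inc
  ; r< = c< ; c< = r< ; onX = λ i j q → swap i j (onX j i q) }
  where
  open XPermutation X
  swap : ∀ i j → r j ≡ c i ⊎ r j + c i + 1 ≡ _ → c i ≡ r j ⊎ c i + r j + 1 ≡ _
  swap i j (inj₁ p) = inj₁ (sym p)
  swap i j (inj₂ p) = inj₂ (trans (cong (_+ 1) (+-comm (c i) (r j))) p)

Cont-transpose : ∀ {l} {Q : Matrix l l} (A : BMat) → Cont (flip A) (flip Q) → Cont A Q
Cont-transpose A (r , c , rinc , cinc , sub) = c , r , cinc , rinc , λ i j → sub j i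

-- A dense matrix contains every permutation matrix inside X.

not-∧ : ∀ a b → ⟦ not (a ∧ b) ⟧ ≤ ⟦ not a ⟧ + ⟦ not b ⟧
not-∧ true  b = ≤-refl
not-∧ false b = s≤s z≤n

module _ (m : ℕ) where

  -- The reflection of [0, 4m): row x of X_{4m} has its 1-entries in columns x and `opp x`.
  opp : ℕ → ℕ
  opp x = 4 * m ∸ suc x

  -- Sends the layers 0, …, m − 1 of X_{2m} to the layers g 0 < … < g (m − 1) of X_{4m}.
  spread : (ℕ → ℕ) → ℕ → ℕ
  spread g a with a <? m
  ... | yes _ = g a
  ... | no  _ = opp (g (2 * m ∸ suc a))

  spread-low : ∀ g {a} → a < m → spread g a ≡ g a
  spread-low g {a} a<m with a <? m
  ... | yes _ = refl
  ... | no ¬p = ⊥-elim (¬p a<m)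

  spread-high : ∀ g {a} → ¬ a < m → spread g a ≡ opp (g (2 * m ∸ suc a))
  spread-high g {a} ¬a<m with a <? m
  ... | yes p = ⊥-elim (¬a<m p)
  ... | no _  = refl

  mirror : ∀ {a b} → a + b + 1 ≡ 2 * m → b ≡ 2 * m ∸ suc a
  mirror {a} {b} p = sym (trans (cong (_∸ suc a) (trans (sym p) (lem a b))) (m+n∸m≡n (suc a) b))
    where
    lem : ∀ a b → a + b + 1 ≡ suc a + b
    lem = solve-∀

  mirror′ : ∀ {a} → a < 2 * m → a + (2 * m ∸ suc a) + 1 ≡ 2 * m
  mirror′ {a} lt = trans (lem a (2 * m ∸ suc a)) (m+[n∸m]≡n lt)
    where
    lem : ∀ a b → a + b + 1 ≡ suc a + b
    lem = solve-∀

  mirror-< : ∀ {a b} → a + b + 1 ≡ 2 * m → ¬ a < m → b < m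
  mirror-< {a} {b} p ¬a<m = +-cancelˡ-≤ m _ _ (begin
    m + suc b    ≤⟨ +-monoˡ-≤ (suc b) (≮⇒≥ ¬a<m) ⟩
    a + suc b    ≡⟨ lem a b ⟩
    a + b + 1    ≡⟨ p ⟩
    2 * m        ≡⟨ lem₂ m ⟩
    m + m        ∎)
    where
    lem : ∀ a b → a + suc b ≡ a + b + 1
    lem = solve-∀
    lem₂ : ∀ m → 2 * m ≡ m + m
    lem₂ = solve-∀

  mirror-≮ : ∀ {a b} → a + b + 1 ≡ 2 * m → a < m → ¬ b < m
  mirror-≮ {a} {b} p a<m b<m = <-irrefl (trans (lem a b) (trans (cong suc p) (lem₂ m)))
    (+-mono-≤-< a<m (s<s b<m))
    where
    lem : ∀ a b → suc a + suc b ≡ suc (a + b + 1)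
    lem = solve-∀
    lem₂ : ∀ m → suc (2 * m) ≡ m + suc m
    lem₂ = solve-∀

  opp-≥ : ∀ {x} → x < 2 * m → 2 * m ≤ opp x
  opp-≥ {x} lt = begin
    2 * m            ≡⟨ m+n∸n≡m (2 * m) (2 * m) ⟨
    2 * m + 2 * m ∸ 2 * m   ≡⟨ cong (_∸ 2 * m) (lem m) ⟩
    4 * m ∸ 2 * m    ≤⟨ ∸-monoʳ-≤ (4 * m) lt ⟩
    4 * m ∸ suc x    ∎
    where
    lem : ∀ m → 2 * m + 2 * m ≡ 4 * m
    lem = solve-∀

  2m≤4m : 2 * m ≤ 4 * m
  2m≤4m = *-monoˡ-≤ m {2} {4} (s≤s (s≤s z≤n))

  -- Values of `g` on the lower half stay below 2m and their reflections are at least 2m, so the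
  -- halves do not interleave. Within the upper half the order is reversed twice.
  spread-inc : ∀ g → (∀ {a b} → a < b → g a < g b) → (∀ {a} → a < m → g a < 2 * m) →
    ∀ {a b} → a < b → b < 2 * m → spread g a < spread g b
  spread-inc g inc bnd {a} {b} a<b b<2m with a <? m | b <? m
  ... | yes _    | yes _ = inc a<b
  ... | yes a<m  | no ¬b = <-≤-trans (bnd a<m) (opp-≥ (bnd (mirror-< (mirror′ b<2m) ¬b)))
  ... | no ¬a    | yes b<m = ⊥-elim (¬a (<-trans a<b b<m))
  ... | no ¬a    | no ¬b = ∸-monoʳ-< (s<s (inc (∸-monoʳ-< (s<s a<b) b<2m)))
                             (<-≤-trans (bnd (mirror-< (mirror′ (<-trans a<b b<2m)) ¬a)) 2m≤4m)

  module _ (0<m : 0 < m) (s : ℕ) (D : BMat) (C : ℕ → Bool) (J : ℕ)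
           (S≡ : count s C ≡ 4 * m + J) (4m≤J : 4 * m ≤ J)
           (D⊆C : ∀ {u} → u < 4 * m → ∀ y → D u y ≡ true → C y ≡ true)
           (dense : ∀ {u} → u < 4 * m → 31 * count s C ≤ 32 * count s (D u)) where

    private
      S : ℕ
      S = count s C
      e : ℕ → ℕ
      e = enum s C
      miss : ℕ → ℕ
      miss u = count S (λ i → not (D u (e i)))

    -- Every 1-entry of row `u` lies in a column of `C`, so its hits and misses along the
    -- enumeration of `C` add up to `S`; density leaves at most S/32 misses.
    miss-small : ∀ {u} → u < 4 * m → 32 * miss u ≤ S
    miss-small {u} u< = +-cancelʳ-≤ (31 * S) _ _ (begin
      32 * miss u + 31 * S              ≤⟨ +-monoʳ-≤ (32 * miss u) (dense u<) ⟩
      32 * miss u + 32 * count s (D u)  ≤⟨ +-monoʳ-≤ (32 * miss u) (*-monoʳ-≤ 32 hit) ⟩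
      32 * miss u + 32 * hits           ≡⟨ *-distribˡ-+ 32 (miss u) hits ⟨
      32 * (miss u + hits)              ≡⟨ cong (32 *_) (+-comm (miss u) hits) ⟩
      32 * (hits + miss u)              ≡⟨ cong (32 *_) (count-not S (D u ∘ e)) ⟩
      32 * S                            ≡⟨⟩
      S + 31 * S                        ∎)
      where
      hits : ℕ
      hits = count S (D u ∘ e)
      pt : ∀ y → ⟦ D u y ⟧ ≤ ⟦ C y ⟧ * ⟦ D u y ⟧
      pt y with D u y in eq
      ... | false = z≤n
      ... | true rewrite D⊆C u< y eq = ≤-refl
      hit : count s (D u) ≤ hits
      hit = ≤-trans (∑-mono s λ y _ → pt y) (≤-reflexive (sym (∑-enum s C (⟦_⟧ ∘ D u))))

    -- The four corners of layer `x` of X_{4m}, when its columns are placed at consecutive positions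
    -- of `C` starting from position `j`.
    intact : ℕ → ℕ → Bool
    intact j x = (D x (e (x + j)) ∧ D x (e (opp x + j)))
               ∧ (D (opp x) (e (x + j)) ∧ D (opp x) (e (opp x + j)))

    opp-< : ∀ {x} → x < 2 * m → opp x < 4 * m
    opp-< x< = ∸-monoʳ-< z<s (<-≤-trans x< 2m≤4m)

    -- A broken layer has a missing corner. As the shift varies, each corner runs through a window
    -- of a single row and is missing at most S/32 times, which gives S/8 for the four corners.
    broken-few : ∀ {x} → x < 2 * m → 8 * ∑ J (λ j → ⟦ not (intact j x) ⟧) ≤ S
    broken-few {x} x< = *-cancelˡ-≤ 4 (begin
      4 * (8 * ∑ J (λ j → ⟦ not (intact j x) ⟧))
        ≤⟨ *-monoʳ-≤ 4 (*-monoʳ-≤ 8 (≤-trans (∑-mono J λ j _ → split j) (≤-reflexive sums))) ⟩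
      4 * (8 * (∑ J (w x x) + ∑ J (w x (opp x)) + (∑ J (w (opp x) x) + ∑ J (w (opp x) (opp x)))))
        ≤⟨ *-monoʳ-≤ 4 (*-monoʳ-≤ 8 (+-mono-≤
             (+-mono-≤ (win x x≤) (win x o≤)) (+-mono-≤ (win (opp x) x≤) (win (opp x) o≤)))) ⟩
      4 * (8 * (miss x + miss x + (miss (opp x) + miss (opp x))))
        ≡⟨ lem (miss x) (miss (opp x)) ⟩
      32 * miss x + 32 * miss x + (32 * miss (opp x) + 32 * miss (opp x))
        ≤⟨ +-mono-≤ (+-mono-≤ mx mx) (+-mono-≤ mo mo) ⟩
      S + S + (S + S)
        ≡⟨ lem₂ S ⟩
      4 * S ∎)
      where
      w : ℕ → ℕ → ℕ → ℕ
      w u v j = ⟦ not (D u (e (v + j))) ⟧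
      x<4m = <-≤-trans x< 2m≤4m
      x≤ = <⇒≤ x<4m
      o≤ = <⇒≤ (opp-< x<)
      mx = miss-small x<4m
      mo = miss-small (opp-< x<)
      split : ∀ j → ⟦ not (intact j x) ⟧ ≤ w x x j + w x (opp x) j + (w (opp x) x j + w (opp x) (opp x) j)
      split j = ≤-trans (not-∧ (D x (e (x + j)) ∧ D x (e (opp x + j))) _)
                        (+-mono-≤ (not-∧ (D x (e (x + j))) _) (not-∧ (D (opp x) (e (x + j))) _))
      sums = trans (∑-+ J _ _) (cong₂ _+_ (∑-+ J _ _) (∑-+ J _ _))
      win : ∀ u {v} → v ≤ 4 * m → ∑ J (w u v) ≤ miss u
      win u {v} v≤ = ∑-window v J (λ i → ⟦ not (D u (e i)) ⟧)
                       (≤-trans (+-monoˡ-≤ J v≤) (≤-reflexive (sym S≡)))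
      lem : ∀ a b → 4 * (8 * (a + a + (b + b))) ≡ 32 * a + 32 * a + (32 * b + 32 * b)
      lem = solve-∀
      lem₂ : ∀ a → a + a + (a + a) ≡ 4 * a
      lem₂ = solve-∀

    -- Averaging over the `J` shifts: the broken layers number at most 2m · S/8 in total, and S ≤ 2J
    -- turns this into at most mJ/2, below J(m + 1).
    good-shift : ∃ λ j → j < J × count (2 * m) (λ x → not (intact j x)) ≤ m
    good-shift = ∑-pigeonhole J m _ (*-cancelˡ-< 8 _ _ (begin-strict
      8 * ∑ J (λ j → ∑ (2 * m) (λ x → ⟦ not (intact j x) ⟧))
        ≡⟨ cong (8 *_) (∑-swap J (2 * m) (λ j x → ⟦ not (intact j x) ⟧)) ⟩
      8 * ∑ (2 * m) (λ x → ∑ J (λ j → ⟦ not (intact j x) ⟧))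
        ≡⟨ ∑-*ˡ (2 * m) 8 _ ⟨
      ∑ (2 * m) (λ x → 8 * ∑ J (λ j → ⟦ not (intact j x) ⟧))
        ≤⟨ ∑-mono (2 * m) (λ x x< → broken-few x<) ⟩
      ∑ (2 * m) (λ _ → S)
        ≡⟨ ∑-const (2 * m) S ⟩
      2 * m * S
        ≡⟨ cong (2 * m *_) S≡ ⟩
      2 * m * (4 * m + J)
        ≤⟨ *-monoʳ-≤ (2 * m) (+-monoˡ-≤ J 4m≤J) ⟩
      2 * m * (J + J)
        ≤⟨ m≤m+n _ (4 * (J * m)) ⟩
      2 * m * (J + J) + 4 * (J * m)
        <⟨ m<m+n _ (*-mono-≤ {1} {8} (s≤s z≤n) 0<J) ⟩
      2 * m * (J + J) + 4 * (J * m) + 8 * J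
        ≡⟨ lem m J ⟩
      8 * (J * suc m) ∎))
      where
      0<J : 0 < J
      0<J = <-≤-trans 0<m (≤-trans (m≤m+n m _) 4m≤J)
      lem : ∀ m J → 2 * m * (J + J) + 4 * (J * m) + 8 * J ≡ 8 * (J * suc m)
      lem = solve-∀

    -- With at most `m` of the 2m layers broken, at least `m` are intact. `g` lists them from the
    -- outside in, and `spread g` places X_{2m} on exactly those layers.
    translate⇒Cont : ∀ {l} {Q : Matrix l l} → XPermutation (2 * m) Q →
      ∀ j → count (2 * m) (not ∘ intact j) ≤ m → Cont D Q
    translate⇒Cont X j few = ρ ∘ r , (λ i → e (ρ (c i) + j)) ,
      (λ a b a<b → ρ-inc (r-inc a b a<b) (r< b)) ,
      (λ a b a<b → enum-inc s C (+-monoˡ-< j (ρ-inc (c-inc a b a<b) (c< b)))) ,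
      λ a b q → entry (r< a) (onX a b q)
      where
      open XPermutation X
      g : ℕ → ℕ
      g = enum (2 * m) (intact j)
      ρ : ℕ → ℕ
      ρ = spread g
      m≤count : m ≤ count (2 * m) (intact j)
      m≤count = +-cancelʳ-≤ m _ _ (begin
        m + m        ≡⟨ lem m ⟩
        2 * m        ≡⟨ count-not (2 * m) (intact j) ⟨
        count (2 * m) (intact j) + count (2 * m) (not ∘ intact j)
                     ≤⟨ +-monoʳ-≤ _ few ⟩
        count (2 * m) (intact j) + m ∎)
        where
        lem : ∀ m → m + m ≡ 2 * m
        lem = solve-∀
      ρ-inc : ∀ {a b} → a < b → b < 2 * m → ρ a < ρ b
      ρ-inc = spread-inc g (enum-inc (2 * m) (intact j))
                (λ a<m → enum-< (2 * m) (intact j) (<-≤-trans a<m m≤count))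
      corners : ∀ {a} → a < m → let x = g a in
        (D x (e (x + j)) ≡ true × D x (e (opp x + j)) ≡ true) ×
        (D (opp x) (e (x + j)) ≡ true × D (opp x) (e (opp x + j)) ≡ true)
      corners a<m with ∧-true (enum-true (2 * m) (intact j) (<-≤-trans a<m m≤count))
      ... | p , q = ∧-true p , ∧-true q
      at : ∀ {a b u v} → u ≡ ρ a → v ≡ ρ b → D u (e (v + j)) ≡ true → D (ρ a) (e (ρ b + j)) ≡ true
      at = subst₂ (λ u v → D u (e (v + j)) ≡ true)
      low : ∀ {a} → a < m → g a ≡ ρ a
      low = sym ∘ spread-low g
      high : ∀ {a b} → b ≡ 2 * m ∸ suc a → ¬ a < m → opp (g b) ≡ ρ a
      high refl = sym ∘ spread-high g
      -- A diagonal entry has row and column in the same half and an antidiagonal entry has them in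
      -- opposite halves; with the half of the row this selects one of the four corners.
      entry : ∀ {a b} → a < 2 * m → a ≡ b ⊎ a + b + 1 ≡ 2 * m → D (ρ a) (e (ρ b + j)) ≡ true
      entry {a} a< (inj₁ refl) = case a <? m of λ where
        (yes a<m) → at (low a<m) (low a<m) (proj₁ (proj₁ (corners a<m)))
        (no ¬a)   → at (high refl ¬a) (high refl ¬a) (proj₂ (proj₂ (corners (mirror-< (mirror′ a<) ¬a))))
      entry {a} {b} a< (inj₂ p) = case a <? m of λ where
        (yes a<m) → at (low a<m) (high (mirror (trans (cong (_+ 1) (+-comm b a)) p)) (mirror-≮ p a<m))
                       (proj₂ (proj₁ (corners a<m)))
        (no ¬a)   → let b<m = mirror-< p ¬a in
                    at (high (mirror p) ¬a) (low b<m) (proj₁ (proj₂ (corners b<m)))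

    dense⇒Cont : ∀ {l} {Q : Matrix l l} → XPermutation (2 * m) Q → Cont D Q
    dense⇒Cont X = translate⇒Cont X (proj₁ good-shift) (proj₂ (proj₂ good-shift))

-- Few wide blocks in a strip, by density decrement.

module _ (m : ℕ) (0<m : 0 < m) {l : ℕ} {Q : Matrix l l} (X : XPermutation (2 * m) Q)
         (s t : ℕ) (8m≤t : 8 * m ≤ t) where

  private
    K : ℕ
    K = 4 * m

    0<K^ : ∀ L → 0 < K ^ L
    0<K^ zero    = z<s
    0<K^ (suc L) = *-mono-≤ {1} {K} {1} (≤-trans 0<m (m≤m+n m _)) (0<K^ L)

  union : BMat → ℕ → ℕ → ℕ → Bool
  union R L a y = any< (K ^ L) (λ z → R (a + z) y)

  ≤union : ∀ R L a → t ≤ count s (R a) → t ≤ count s (union R L a)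
  ≤union R L a h = ≤-trans h (∑-mono s λ y _ → ⟦⟧-mono λ p →
    any-intro (K ^ L) (λ z → R (a + z) y) (0<K^ L)
      (trans (cong (λ x → R x y) (+-identityʳ a)) p))

  -- Induction on `L`. The inequality says, without division, that the union meets fewer than
  -- (32/31)^L · t columns. Passing to a sparse part costs one level and a factor 31/32, so it is
  -- preserved; at level 0 it would leave fewer than `t` columns, against richness.
  rich-rows⇒Cont : ∀ R L a → (∀ z → a ≤ z → z < a + K ^ L → t ≤ count s (R z)) →
    31 ^ L * count s (union R L a) < 32 ^ L * t → Cont R Q
  rich-rows⇒Cont R zero a rich lt = ⊥-elim (<⇒≱ lt (*-monoʳ-≤ 1
    (≤union R 0 a (rich a ≤-refl (m<m+n a (0<K^ 0))))))
  rich-rows⇒Cont R (suc L) a rich lt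
    -- The interval is cut into `K` = 4m parts of length K^L; a part is sparse if it meets fewer
    -- than 31/32 of the columns of the whole.
    with anyUpTo? (λ u → 32 * count s (union R L (a + u * K ^ L)) <? 31 * count s (union R (suc L) a)) K
  ... | yes (u , u<K , sparse) = rich-rows⇒Cont R L (a + u * K ^ L)
          (λ z le z< → rich z (≤-trans (m≤m+n a _) le) (<-≤-trans z< (end u<K)))
          (*-cancelˡ-< 32 _ _ (begin-strict
            32 * (31 ^ L * C′)    ≡⟨ swap 32 (31 ^ L) C′ ⟩
            31 ^ L * (32 * C′)    ≤⟨ *-monoʳ-≤ (31 ^ L) (<⇒≤ sparse) ⟩
            31 ^ L * (31 * C)     ≡⟨ swap (31 ^ L) 31 C ⟩
            31 * (31 ^ L * C)     ≡⟨ *-assoc 31 (31 ^ L) C ⟨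
            31 ^ suc L * C        <⟨ lt ⟩
            32 ^ suc L * t        ≡⟨ *-assoc 32 (32 ^ L) t ⟩
            32 * (32 ^ L * t)     ∎))
    where
    C C′ : ℕ
    C  = count s (union R (suc L) a)
    C′ = count s (union R L (a + u * K ^ L))
    swap : ∀ x y z → x * (y * z) ≡ y * (x * z)
    swap = solve-∀
    end : ∀ {u} → u < K → a + u * K ^ L + K ^ L ≤ a + K ^ suc L
    end {u} u<K = begin
      a + u * K ^ L + K ^ L    ≡⟨ +-assoc a _ _ ⟩
      a + (u * K ^ L + K ^ L)  ≡⟨ cong (a +_) (+-comm (u * K ^ L) (K ^ L)) ⟩
      a + suc u * K ^ L        ≤⟨ +-monoʳ-≤ a (*-monoˡ-≤ (K ^ L) u<K) ⟩
      a + K * K ^ L            ∎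
  -- No part is sparse, so the matrix `D` with one row per part is dense. A 1-entry of `D` lifts to
  -- some row of its part, in the same column.
  ... | no ¬sparse = contract (XPermutation.perm X) R D (Block a (K ^ L) (λ u → u)) _≡_
          (Block-separated a (K ^ L) (λ u → u) (λ lt → lt)) (λ { u<v refl refl → u<v })
          (λ u v p → let z , z< , q = any-elim (K ^ L) (λ z → R (a + u * K ^ L + z) v) p in
            a + (u * K ^ L + z) , v ,
            trans (cong (λ x → R x v) (sym (+-assoc a (u * K ^ L) z))) q , (z , z< , refl) , refl)
          (dense⇒Cont m 0<m s D (union R (suc L) a) J (sym K+J≡) K≤J D⊆
            (λ {u} u<K → ≮⇒≥ λ sparse → ¬sparse (u , u<K , sparse)) X)
    where
    D : BMat
    D u = union R L (a + u * K ^ L)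
    S : ℕ
    S = count s (union R (suc L) a)
    -- Half of these 8m columns hold a copy of X_{4m}, and the rest leave room for at least 4m
    -- shifts.
    8m≤S : 8 * m ≤ S
    8m≤S = ≤-trans 8m≤t (≤union R (suc L) a (rich a ≤-refl (m<m+n a (0<K^ (suc L)))))
    K+K≤S : K + K ≤ S
    K+K≤S = ≤-trans (≤-reflexive (lem m)) 8m≤S
      where
      lem : ∀ m → 4 * m + 4 * m ≡ 8 * m
      lem = solve-∀
    J : ℕ
    J = S ∸ K
    K+J≡ : K + J ≡ S
    K+J≡ = m+[n∸m]≡n (≤-trans (m≤m+n K K) K+K≤S)
    K≤J : K ≤ J
    K≤J = +-cancelˡ-≤ K _ _ (≤-trans K+K≤S (≤-reflexive (sym K+J≡)))
    D⊆ : ∀ {u} → u < K → ∀ y → D u y ≡ true → union R (suc L) a y ≡ true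
    D⊆ {u} u<K y p with any-elim (K ^ L) (λ z → R (a + u * K ^ L + z) y) p
    ... | z , z< , q = any-intro (K ^ suc L) (λ z → R (a + z) y) {u * K ^ L + z}
            (begin-strict
              u * K ^ L + z      <⟨ +-monoʳ-< (u * K ^ L) z< ⟩
              u * K ^ L + K ^ L  ≡⟨ +-comm (u * K ^ L) (K ^ L) ⟩
              suc u * K ^ L      ≤⟨ *-monoˡ-≤ (K ^ L) u<K ⟩
              K * K ^ L          ∎)
            (trans (cong (λ x → R x y) (sym (+-assoc a (u * K ^ L) z))) q)

  blockCol : BMat → ℕ → ℕ → ℕ → Bool
  blockCol A i j y = any< s (λ x → A (i * s + x) (j * s + y))

  wide : BMat → ℕ → ℕ → Bool
  wide A j i = t ≤ᵇ count s (blockCol A i j)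

  -- With more than K^L wide blocks in the strip, the first K^L of them, each collapsed to the row
  -- of its nonempty columns, are rich rows. They have only `s` columns to meet, so `lt` starts the
  -- decrement.
  few-wide : ∀ A L → 31 ^ L * s < 32 ^ L * t → ¬ Cont A Q → ∀ j n → count n (wide A j) ≤ K ^ L
  few-wide A L lt avoids j n with count n (wide A j) ≤? K ^ L
  ... | yes p = p
  ... | no ¬p = ⊥-elim (avoids (contract (XPermutation.perm X) A R
          -- A row of `R` lifts to the `s` rows of its block; a column lifts to the single column j
          -- · s + v, written as an interval of width 1.
          (Block 0 s e) (Block (j * s) 1 (λ y → y))
          (Block-separated 0 s e (enum-inc n (wide A j))) (Block-separated (j * s) 1 _ (λ lt → lt))
          (λ u v p → let x , x< , q = any-elim s (λ x → A (e u * s + x) (j * s + v)) p in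
             e u * s + x , j * s + v , q , (x , x< , refl) ,
             (0 , z<s , cong (j * s +_) (sym (trans (+-identityʳ _) (*-identityʳ v)))))
          (rich-rows⇒Cont R L 0
             (λ z _ z< → ≤ᵇ⇒≤ t _ (subst T (sym (enum-true n (wide A j) (<-trans z< (≰⇒> ¬p)))) _))
             (≤-<-trans (*-monoʳ-≤ (31 ^ L) (count≤ s _)) lt))))
    where
    e : ℕ → ℕ
    e = enum n (wide A j)
    R : BMat
    R z = blockCol A (e z) j

-- Block contraction and the linear bound.

size : ℕ → BMat → ℕ
size n A = ∑ n (λ x → count n (A x))

module _ (m : ℕ) (0<m : 0 < m) {l : ℕ} {Q : Matrix l l} (X : XPermutation (2 * m) Q)
         (s t L b : ℕ) (8m≤t : 8 * m ≤ t) (lt : 31 ^ L * s < 32 ^ L * t)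
         (4tt≤s : 4 * (t * t) ≤ s) (N≤b : 8 * (s * (4 * m) ^ L) ≤ b) where

  private
    N₀ : ℕ
    N₀ = (4 * m) ^ L

    -- `Tall` is wideness of the transposed block, so its strip is the row strip `i`.
    Wide Tall : BMat → BMat
    Wide A i j = wide m 0<m X s t 8m≤t A j i
    Tall A i j = wide m 0<m (X-transpose X) s t 8m≤t (flip A) i j

    shrink : BMat → BMat
    shrink A i j = any< s (λ x → any< s (λ y → A (i * s + x) (j * s + y)))

    blockSize : BMat → ℕ → ℕ → ℕ
    blockSize A i j = ∑ s (λ x → count s (λ y → A (i * s + x) (j * s + y)))

    0<t : 0 < t
    0<t = <-≤-trans 0<m (≤-trans (m≤m+n m _) 8m≤t)

    4≤s : 4 ≤ s
    4≤s = ≤-trans (*-monoʳ-≤ 4 (*-mono-≤ 0<t 0<t)) 4tt≤s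

    instance
      s≢0 : NonZero s
      s≢0 = >-nonZero (<-≤-trans z<s 4≤s)

  shrink-avoids : ∀ A → ¬ Cont A Q → ¬ Cont (shrink A) Q
  shrink-avoids A avoids h = avoids (contract (XPermutation.perm X) A (shrink A) B B sep sep
    (λ u v p →
      let x , x< , q  = any-elim s _ p
          y , y< , q′ = any-elim s (λ y → A (u * s + x) (v * s + y)) q
      in u * s + x , v * s + y , q′ , (x , x< , refl) , (y , y< , refl))
    h)
    where
    B : ℕ → ℕ → Set
    B = Block 0 s (λ u → u)
    sep : Separated B
    sep = Block-separated 0 s (λ u → u) (λ u<v → u<v)

  -- A 1-entry lies in a nonempty row and a nonempty column, so the product of their numbers bounds
  -- the block. Both numbers are below `t` unless the block is wide or tall, and then the trivial s²
  -- is charged.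
  blockSize-bound : ∀ A i j →
    blockSize A i j ≤ t * t * ⟦ shrink A i j ⟧ + s * s * (⟦ Wide A i j ⟧ + ⟦ Tall A i j ⟧)
  blockSize-bound A i j = begin
    blockSize A i j
      ≤⟨ ∑-mono s (λ x x< → ∑-mono s (λ y y< → pt x y x< y<)) ⟩
    ∑ s (λ x → ∑ s (λ y → β * (⟦ row x ⟧ * ⟦ col y ⟧)))
      ≡⟨ ∑-cong s (λ x → trans (∑-*ˡ s β _) (cong (β *_) (∑-*ˡ s ⟦ row x ⟧ _))) ⟩
    ∑ s (λ x → β * (⟦ row x ⟧ * count s col))
      ≡⟨ trans (∑-*ˡ s β _) (cong (β *_) (∑-*ʳ s (count s col) (⟦_⟧ ∘ row))) ⟩
    β * (count s row * count s col)
      ≤⟨ final ⟩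
    t * t * β + s * s * (⟦ Wide A i j ⟧ + ⟦ Tall A i j ⟧) ∎
    where
    row col : ℕ → Bool
    row x = any< s (λ y → A (i * s + x) (j * s + y))
    col y = any< s (λ x → A (i * s + x) (j * s + y))
    β : ℕ
    β = ⟦ shrink A i j ⟧
    pt : ∀ x y → x < s → y < s → ⟦ A (i * s + x) (j * s + y) ⟧ ≤ β * (⟦ row x ⟧ * ⟦ col y ⟧)
    pt x y x< y< with A (i * s + x) (j * s + y) in eq
    ... | false = z≤n
    ... | true  = *-mono-≤ {1} {β} {1} (hit (any-intro s row x< rowx)) (*-mono-≤ {1} {⟦ row x ⟧} {1}
                    (hit rowx) (hit (any-intro s (λ x → A (i * s + x) (j * s + y)) x< eq)))
      where
      rowx : row x ≡ true
      rowx = any-intro s (λ y → A (i * s + x) (j * s + y)) y< eq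
      hit : ∀ {c} → c ≡ true → 1 ≤ ⟦ c ⟧
      hit refl = ≤-refl
    full : β * (count s row * count s col) ≤ s * s * 1
    full = ≤-trans (*-mono-≤ (⟦⟧≤1 (shrink A i j)) (*-mono-≤ (count≤ s row) (count≤ s col)))
                   (≤-reflexive (*-comm 1 (s * s)))
    small : ∀ {c} → (t ≤ᵇ c) ≡ false → c ≤ t
    small {c} p = <⇒≤ (≰⇒> λ t≤c → subst T p (≤⇒≤ᵇ t≤c))
    final : β * (count s row * count s col) ≤ t * t * β + s * s * (⟦ Wide A i j ⟧ + ⟦ Tall A i j ⟧)
    final with Wide A i j in eqW | Tall A i j in eqT
    ... | true  | v     = ≤-trans full (≤-trans (*-monoʳ-≤ (s * s) (m≤m+n 1 ⟦ v ⟧)) (m≤n+m _ (t * t * β)))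
    ... | false | true  = ≤-trans full (m≤n+m _ (t * t * β))
    ... | false | false = ≤-trans (*-monoʳ-≤ β (*-mono-≤ (small eqT) (small eqW)))
                            (≤-trans (≤-reflexive (*-comm β (t * t))) (m≤m+n _ _))

  size-blocks : ∀ n A → size (n * s) A ≡ ∑ n (λ i → ∑ n (λ j → blockSize A i j))
  size-blocks n A = trans (∑-blocks n s _) (∑-cong n λ i →
    trans (∑-cong s λ x → ∑-blocks n s _) (∑-swap s n _))

  -- Wide blocks are few in each column strip, tall blocks in each row strip, so each kind occurs at
  -- most n · `N₀` times.
  size-shrink : ∀ n A → ¬ Cont A Q →
    size (n * s) A ≤ t * t * size n (shrink A) + s * s * (n * N₀ + n * N₀)
  size-shrink n A avoids = begin
    size (n * s) A
      ≡⟨ size-blocks n A ⟩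
    ∑ n (λ i → ∑ n (λ j → blockSize A i j))
      ≤⟨ ∑-mono n (λ i _ → ∑-mono n (λ j _ → blockSize-bound A i j)) ⟩
    ∑ n (λ i → ∑ n (λ j → t * t * ⟦ shrink A i j ⟧ + s * s * (⟦ Wide A i j ⟧ + ⟦ Tall A i j ⟧)))
      ≡⟨ trans (∑-cong n λ i → ∑-+ n _ _) (∑-+ n _ _) ⟩
    ∑ n (λ i → ∑ n (λ j → t * t * ⟦ shrink A i j ⟧))
      + ∑ n (λ i → ∑ n (λ j → s * s * (⟦ Wide A i j ⟧ + ⟦ Tall A i j ⟧)))
      ≡⟨ cong₂ _+_ (pull (t * t)) (trans (pull (s * s)) (cong (s * s *_)
           (trans (∑-cong n λ i → ∑-+ n _ _) (∑-+ n _ _)))) ⟩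
    t * t * size n (shrink A)
      + s * s * (∑ n (λ i → count n (Wide A i)) + ∑ n (λ i → count n (Tall A i)))
      ≤⟨ +-monoʳ-≤ _ (*-monoʳ-≤ (s * s) (+-mono-≤ wides talls)) ⟩
    t * t * size n (shrink A) + s * s * (n * N₀ + n * N₀) ∎
    where
    pull : ∀ c {f : ℕ → ℕ → ℕ} → ∑ n (λ i → ∑ n (λ j → c * f i j)) ≡ c * ∑ n (λ i → ∑ n (f i))
    pull c = trans (∑-cong n λ i → ∑-*ˡ n c _) (∑-*ˡ n c _)
    wides : ∑ n (λ i → count n (Wide A i)) ≤ n * N₀
    wides = begin
      ∑ n (λ i → count n (Wide A i))             ≡⟨ ∑-swap n n (λ i j → ⟦ Wide A i j ⟧) ⟩
      ∑ n (λ j → count n (λ i → Wide A i j))     ≤⟨ ∑-mono n (λ j _ → few-wide m 0<m X s t 8m≤t A L lt avoids j n) ⟩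
      ∑ n (λ _ → N₀)                             ≡⟨ ∑-const n N₀ ⟩
      n * N₀                                     ∎
    talls : ∑ n (λ i → count n (Tall A i)) ≤ n * N₀
    talls = begin
      ∑ n (λ i → count n (Tall A i))   ≤⟨ ∑-mono n (λ i _ → few-wide m 0<m (X-transpose X) s t 8m≤t
                                            (flip A) L lt (avoids ∘ Cont-transpose A) i n) ⟩
      ∑ n (λ _ → N₀)                   ≡⟨ ∑-const n N₀ ⟩
      n * N₀                           ∎

  size-mono : ∀ {n p} A → n ≤ p → size n A ≤ size p A
  size-mono {n} {p} A n≤p = ≤-trans (∑-range _ n≤p) (∑-mono p λ x _ → ∑-range _ n≤p)

  size≤square : ∀ n A → size n A ≤ n * n
  size≤square n A = ≤-trans (∑-mono n λ x _ → count≤ n (A x)) (≤-reflexive (∑-const n n))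

  s≤b : s ≤ b
  s≤b = begin
    s                 ≡⟨ *-identityʳ s ⟨
    s * 1             ≤⟨ *-monoʳ-≤ s 1≤N₀ ⟩
    s * N₀            ≤⟨ m≤m+n _ _ ⟩
    8 * (s * N₀)      ≤⟨ N≤b ⟩
    b                 ∎
    where
    1≤N₀ : 1 ≤ N₀
    1≤N₀ = ≤-trans (≤-reflexive (sym (^-zeroˡ L))) (^-monoˡ-≤ L (≤-trans 0<m (m≤m+n m _)))

  -- Strong induction on the size. The choices s ≥ 4t² and b ≥ 8s`N₀` let the contracted matrix and
  -- the wide and tall blocks each use at most half of b · n; below one block the square bound
  -- suffices.
  linear-bound : ∀ n A → ¬ Cont A Q → size n A ≤ b * n
  linear-bound = <-rec _ step
    where
    step : ∀ n → (∀ {p} → p < n → ∀ A → ¬ Cont A Q → size p A ≤ b * p) →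
      ∀ A → ¬ Cont A Q → size n A ≤ b * n
    step n ih A avoids with n <? s
    ... | yes n<s = ≤-trans (size≤square n A) (*-monoˡ-≤ n (≤-trans (<⇒≤ n<s) s≤b))
    ... | no ¬n<s = *-cancelˡ-≤ 4 (begin
      4 * size n A
        ≤⟨ *-monoʳ-≤ 4 (≤-trans (size-mono A n≤ps) (size-shrink p A avoids)) ⟩
      4 * (t * t * size p (shrink A) + s * s * (p * N₀ + p * N₀))
        ≤⟨ *-monoʳ-≤ 4 (+-monoˡ-≤ _ (*-monoʳ-≤ (t * t) (ih p<n (shrink A) (shrink-avoids A avoids)))) ⟩
      4 * (t * t * (b * p) + s * s * (p * N₀ + p * N₀))
        ≡⟨ lem t b p s N₀ ⟩
      4 * (t * t) * (b * p) + s * p * (8 * (s * N₀))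
        ≤⟨ +-mono-≤ (*-monoˡ-≤ (b * p) 4tt≤s) (*-monoʳ-≤ (s * p) N≤b) ⟩
      s * (b * p) + s * p * b
        ≡⟨ lem₂ s b p ⟩
      2 * b * (p * s)
        ≤⟨ *-monoʳ-≤ (2 * b) ps≤2n ⟩
      2 * b * (n + n)
        ≡⟨ lem₃ b n ⟩
      4 * (b * n) ∎)
      where
      s≤n : s ≤ n
      s≤n = ≮⇒≥ ¬n<s
      p : ℕ
      -- Rounding up covers the whole window. As s ≤ n, the enlarged side p · s is at most 2n.
      p = suc (n / s)
      n≤ps : n ≤ p * s
      n≤ps = begin
        n                    ≡⟨ m≡m%n+[m/n]*n n s ⟩
        n % s + n / s * s    ≤⟨ +-monoˡ-≤ (n / s * s) (<⇒≤ (m%n<n n s)) ⟩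
        s + n / s * s        ∎
      ps≤2n : p * s ≤ n + n
      ps≤2n = +-mono-≤ s≤n (m/n*n≤m n s)
      p<n : p < n
      p<n = *-cancelˡ-< 2 _ _ (begin-strict
        2 * p        <⟨ m<m+n (2 * p) {2 * p} z<s ⟩
        2 * p + 2 * p  ≡⟨ lem₄ p ⟩
        p * 4        ≤⟨ *-monoʳ-≤ p 4≤s ⟩
        p * s        ≤⟨ ps≤2n ⟩
        n + n        ≡⟨ lem₅ n ⟩
        2 * n        ∎)
        where
        lem₄ : ∀ p → 2 * p + 2 * p ≡ p * 4
        lem₄ = solve-∀
        lem₅ : ∀ n → n + n ≡ 2 * n
        lem₅ = solve-∀
      lem : ∀ t b p s N → 4 * (t * t * (b * p) + s * s * (p * N + p * N)) ≡ 4 * (t * t) * (b * p) + s * p * (8 * (s * N))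
      lem = solve-∀
      lem₂ : ∀ s b p → s * (b * p) + s * p * b ≡ 2 * b * (p * s)
      lem₂ = solve-∀
      lem₃ : ∀ b n → 2 * b * (n + n) ≡ 4 * (b * n)
      lem₃ = solve-∀

-- Passage between finite and infinite matrices.

extend : ∀ {n} → (Fin n → Bool) → ℕ → Bool
extend {zero}  v _       = false
extend {suc n} v zero    = v fzero
extend {suc n} v (suc i) = extend (v ∘ fsuc) i

extendMat : ∀ {m n} → Matrix m n → BMat
extendMat A x y = extend (λ f → extend (A f) y) x

extend-elim : ∀ {n} (v : Fin n → Bool) i → extend v i ≡ true → ∃ λ f → toℕ f ≡ i × v f ≡ true
extend-elim {suc n} v zero    p = fzero , refl , p
extend-elim {suc n} v (suc i) p with extend-elim (v ∘ fsuc) i p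
... | f , refl , q = fsuc f , refl , q

count-extend : ∀ n (v : Fin n → Bool) → countTrue n v ≡ count n (extend v)
count-extend zero    v = refl
count-extend (suc n) v = cong (⟦ v fzero ⟧ +_) (count-extend n (v ∘ fsuc))

ones-extend : ∀ m {n} (A : Matrix m n) → ones A ≡ ∑ m (λ x → count n (extendMat A x))
ones-extend zero    A = refl
ones-extend (suc m) A = cong₂ _+_ (count-extend _ (A fzero)) (ones-extend m (A ∘ fsuc))

-- Every row and column of `Q` has a 1-entry, and its image is a `true` entry of the padded matrix.
-- Such entries occur only inside the original range, so all coordinates are in bounds.
Cont⇒Contains : ∀ {m n l} {Q : Matrix l l} → IsPermutationMatrix Q → (A : Matrix m n) →
  Cont (extendMat A) Q → Contains A Q
Cont⇒Contains {m} {n} {l} {Q} (rows , cols) A (r , c , r-inc , c-inc , sub) =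
  row , col ,
  (λ i j i<j → subst₂ _<_ (sym (row≡ i)) (sym (row≡ j)) (r-inc i j i<j)) ,
  (λ i j i<j → subst₂ _<_ (sym (col≡ i)) (sym (col≡ j)) (c-inc i j i<j)) ,
  λ i j q → let f , g , f≡ , g≡ , p = locate i j q in
    subst₂ (λ x y → A x y ≡ true)
      (toℕ-injective (trans f≡ (sym (row≡ i)))) (toℕ-injective (trans g≡ (sym (col≡ j)))) p
  where
  locate : ∀ i j → Q i j ≡ true → ∃ λ f → ∃ λ g → toℕ f ≡ r i × toℕ g ≡ c j × A f g ≡ true
  locate i j q with extend-elim (λ f → extend (A f) (c j)) (r i) (sub i j q)
  ... | f , f≡ , p with extend-elim (A f) (c j) p
  ...   | g , g≡ , p′ = f , g , f≡ , g≡ , p′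
  atRow : ∀ i → ∃ λ f → ∃ λ g → toℕ f ≡ r i × toℕ g ≡ c _ × A f g ≡ true
  atRow i = locate i _ (proj₁ (proj₂ (rows i)))
  atCol : ∀ j → ∃ λ f → ∃ λ g → toℕ f ≡ r _ × toℕ g ≡ c j × A f g ≡ true
  atCol j = locate _ j (proj₁ (proj₂ (cols j)))
  row : Fin l → Fin m
  row i = proj₁ (atRow i)
  row≡ : ∀ i → toℕ (row i) ≡ r i
  row≡ i = proj₁ (proj₂ (proj₂ (atRow i)))
  col : Fin l → Fin n
  col j = proj₁ (proj₂ (atCol j))
  col≡ : ∀ j → toℕ (col j) ≡ c j
  col≡ j = proj₁ (proj₂ (proj₂ (proj₂ (atCol j))))

toXPermutation : ∀ {k l} {Q : Matrix l l} → IsPermutationMatrix Q → Contains (X k) Q → XPermutation k Q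
toXPermutation {k} perm (r , c , r-inc , c-inc , sub) = record
  { perm = perm ; r = toℕ ∘ r ; c = toℕ ∘ c ; r-inc = r-inc ; c-inc = c-inc
  ; r< = toℕ<n ∘ r ; c< = toℕ<n ∘ c ; onX = λ i j q → split (r i) (c j) (sub i j q) }
  where
  split : ∀ (a b : Fin k) → X k a b ≡ true → toℕ a ≡ toℕ b ⊎ toℕ a + toℕ b + 1 ≡ k
  split a b p with toℕ a ≡ᵇ toℕ b in eq
  ... | true  = inj₁ (≡ᵇ⇒≡ _ _ (subst T (sym eq) _))
  ... | false = inj₂ (≡ᵇ⇒≡ _ _ (subst T (sym p) _))

-- Numerical constants and the final bound.

n<2^1+⌊log₂n⌋ : ∀ n → n < 2 ^ suc ⌊log₂ n ⌋
n<2^1+⌊log₂n⌋ n = ≰⇒> λ le → <-irrefl refl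
  (≤-trans (≤-reflexive (sym (⌊log₂[2^n]⌋≡n (suc ⌊log₂ n ⌋)))) (⌊log₂⌋-mono-≤ le))

^-distribʳ : ∀ a b n → (a * b) ^ n ≡ a ^ n * b ^ n
^-distribʳ a b zero    = refl
^-distribʳ a b (suc n) = trans (cong (a * b *_) (^-distribʳ a b n)) (lem a b (a ^ n) (b ^ n))
  where
  lem : ∀ a b x y → a * b * (x * y) ≡ a * x * (b * y)
  lem = solve-∀

-- 22 is the least exponent with (32/31)^22 ≥ 2; the case of one factor is checked by evaluation.
decay : ∀ n → 31 ^ (22 * n) * 2 ^ n ≤ 32 ^ (22 * n)
decay n = begin
  31 ^ (22 * n) * 2 ^ n     ≡⟨ cong (_* 2 ^ n) (^-*-assoc 31 22 n) ⟨
  (31 ^ 22) ^ n * 2 ^ n     ≡⟨ ^-distribʳ (31 ^ 22) 2 n ⟨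
  (31 ^ 22 * 2) ^ n         ≤⟨ ^-monoˡ-≤ n (≤ᵇ⇒≤ (31 ^ 22 * 2) (32 ^ 22) _) ⟩
  (32 ^ 22) ^ n             ≡⟨ ^-*-assoc 32 22 n ⟩
  32 ^ (22 * n)             ∎

module _ (m e : ℕ) (0<m : 0 < m) (0<e : 0 < e) (2m<2^ : 2 * m < 2 ^ suc e) where

  private
    t s L : ℕ
    t = 8 * m
    s = 4 * (t * t)
    L = 22 * (6 * e)

  -- The ratio s/t = 32m is below 2^(5 + e), hence at most 2^(6e) as e ≥ 1: 6e halvings, each taking
  -- 22 levels.
  depth-suffices : 31 ^ L * s < 32 ^ L * t
  depth-suffices = begin-strict
    31 ^ L * (4 * (t * t))           ≡⟨ lem (31 ^ L) m ⟩
    31 ^ L * (2 ^ 4 * (2 * m)) * t   <⟨ *-monoˡ-< t {{>-nonZero 0<t}} (*-monoʳ-< (31 ^ L)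
                                        {{>-nonZero (m^n>0 31 L)}} (*-monoʳ-< (2 ^ 4) 2m<2^)) ⟩
    31 ^ L * (2 ^ 4 * 2 ^ suc e) * t ≡⟨ cong (λ x → 31 ^ L * x * t) (^-distribˡ-+-* 2 4 (suc e)) ⟨
    31 ^ L * 2 ^ (4 + suc e) * t     ≤⟨ *-monoˡ-≤ t (*-monoʳ-≤ (31 ^ L) (^-monoʳ-≤ 2 small)) ⟩
    31 ^ L * 2 ^ (6 * e) * t         ≤⟨ *-monoˡ-≤ t (decay (6 * e)) ⟩
    32 ^ L * t                       ∎
    where
    0<t : 0 < t
    0<t = ≤-trans 0<m (m≤m+n m _)
    lem : ∀ x m → x * (4 * (8 * m * (8 * m))) ≡ x * (16 * (2 * m)) * (8 * m)
    lem = solve-∀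
    small : 4 + suc e ≤ 6 * e
    small = begin
      4 + suc e    ≡⟨ lem₂ e ⟩
      5 * 1 + e    ≤⟨ +-monoˡ-≤ e (*-monoʳ-≤ 5 0<e) ⟩
      5 * e + e    ≡⟨ lem₃ e ⟩
      6 * e        ∎
      where
      lem₂ : ∀ e → 4 + suc e ≡ 5 * 1 + e
      lem₂ = solve-∀
      lem₃ : ∀ e → 5 * e + e ≡ 6 * e
      lem₃ = solve-∀

  constant-bound : 8 * (s * (4 * m) ^ L) ≤ 2 ^ (409 * e ^ 2)
  constant-bound = begin
    8 * (s * (4 * m) ^ L)
      ≡⟨ trans (cong (λ x → 8 * (s * x ^ L)) (lem₀ m)) (lem m ((2 * (2 * m)) ^ L)) ⟩
    2 ^ 9 * (2 * m * (2 * m)) * (2 * (2 * m)) ^ L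
      ≤⟨ *-mono-≤ (*-monoʳ-≤ (2 ^ 9) (*-mono-≤ 2m≤ 2m≤)) (^-monoˡ-≤ L (*-monoʳ-≤ 2 2m≤)) ⟩
    2 ^ 9 * (2 ^ suc e * 2 ^ suc e) * (2 ^ suc (suc e)) ^ L
      ≡⟨ cong₂ _*_ (trans (cong (2 ^ 9 *_) (sym (^-distribˡ-+-* 2 (suc e) (suc e))))
                          (sym (^-distribˡ-+-* 2 9 (suc e + suc e)))) (^-*-assoc 2 (suc (suc e)) L) ⟩
    2 ^ (9 + (suc e + suc e)) * 2 ^ (suc (suc e) * L)
      ≡⟨ ^-distribˡ-+-* 2 (9 + (suc e + suc e)) (suc (suc e) * L) ⟨
    2 ^ (9 + (suc e + suc e) + suc (suc e) * L)
      ≤⟨ ^-monoʳ-≤ 2 (exponent 0<e) ⟩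
    2 ^ (409 * e ^ 2) ∎
    where
    2m≤ = <⇒≤ 2m<2^
    lem₀ : ∀ m → 4 * m ≡ 2 * (2 * m)
    lem₀ = solve-∀
    lem : ∀ m x → 8 * (4 * (8 * m * (8 * m)) * x) ≡ 512 * (2 * m * (2 * m)) * x
    lem = solve-∀
    -- The left side is 132e² + 266e + 11, and 132 + 266 + 11 = 409; the added polynomial is the
    -- exact difference for e = d + 1.
    exponent : ∀ {e} → 0 < e → 9 + (suc e + suc e) + suc (suc e) * (22 * (6 * e)) ≤ 409 * e ^ 2
    exponent {suc d} _ = ≤-trans (m≤m+n _ (288 * d + 277 * (d * d))) (≤-reflexive (lem₁ d))
      where
      lem₁ : ∀ d → 9 + (suc (suc d) + suc (suc d)) + suc (suc (suc d)) * (22 * (6 * suc d))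
                   + (288 * d + 277 * (d * d)) ≡ 409 * (suc d * (suc d * 1))
      lem₁ = solve-∀

theorem1p4 : ∃ λ (C : ℕ) → 1 ≤ C ×
    (∀ (k : ℕ) → 2 ≤ k → 2 ∣ k →
    ∀ (l : ℕ) (Q : Matrix l l) → IsPermutationMatrix Q → Contains (X k) Q →
    cBoundedBy Q (2 ^ (C * (⌊log₂ k ⌋ ^ 2))))
theorem1p4 = 409 , s≤s z≤n , bound
  where
  bound : ∀ k → 2 ≤ k → 2 ∣ k → ∀ l (Q : Matrix l l) → IsPermutationMatrix Q → Contains (X k) Q →
    cBoundedBy Q (2 ^ (409 * (⌊log₂ k ⌋ ^ 2)))
  -- The linear bound holds at every size, so the threshold is 0.
  bound k 2≤k (divides m k≡) l Q perm QinX ε = 0 , λ n _ A avoids → begin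
    suc ε * ones A            ≤⟨ *-monoʳ-≤ (suc ε) (begin
      ones A                    ≡⟨ ones-extend n A ⟩
      size n (extendMat A)      ≤⟨ linear-bound m 0<m XQ (4 * (8 * m * (8 * m))) (8 * m) (22 * (6 * e)) c
                                     ≤-refl (depth-suffices m e 0<m 0<e 2m<)
                                     ≤-refl (constant-bound m e 0<m 0<e 2m<) n (extendMat A)
                                     (avoids ∘ Cont⇒Contains perm A) ⟩
      c * n                     ∎) ⟩
    suc ε * (c * n)           ≡⟨ *-assoc (suc ε) c n ⟨
    suc ε * c * n             ≤⟨ m≤m+n _ n ⟩
    suc ε * c * n + n         ∎
    where
    e c : ℕ
    e = ⌊log₂ k ⌋
    c = 2 ^ (409 * e ^ 2)
    k≡2m : k ≡ 2 * m
    k≡2m = trans k≡ (*-comm m 2)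
    0<m : 0 < m
    0<m = *-cancelˡ-< 2 0 m (≤-trans (s≤s z≤n) (≤-trans 2≤k (≤-reflexive k≡2m)))
    0<e : 0 < e
    0<e = ⌊log₂⌋-mono-≤ 2≤k
    2m< : 2 * m < 2 ^ suc e
    2m< = subst (_< 2 ^ suc e) k≡2m (n<2^1+⌊log₂n⌋ k)
    XQ : XPermutation (2 * m) Q
    XQ = subst (λ k → XPermutation k Q) k≡2m (toXPermutation perm QinX)
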